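{- Let $k$ be a positive integer and let $\mathcal L_k$ be the collection of laminar set systems whose laminar trees have down-degree at most $k$. Then there is an $\mathsf{MSO}$-formula $\mathrm{EVEN}_k(X)$ over the vocabulary $\{\mathsf{SET}\}$, with one free set variable $X$, such that for every set system $(U,\mathcal F)\in\mathcal L_k$ and every $X\subseteq U$, the formula $\mathrm{EVEN}_k(X)$ is true in $(U,\mathcal F)$ if and only if $|X|$ is even.
   Context: All structures are finite. $\mathsf{MSO}$ is monadic second-order logic (quantification over elements and sets of elements, no counting predicates). A set system $(U,\mathcal F)$ is a finite non-empty set $U$ with a family $\mathcal F$ of non-empty subsets of $U$; it is modelled as a structure with universe $U$ over the vocabulary $\{\mathsf{SET}\}$, where $\mathsf{SET}$ is a unary predicate on subsets of the universe and $\mathsf{SET}(X)$ holds iff $X\in\mathcal F$. It is laminar if $U\in\mathcal F$, $\{u\}\in\mathcal F$ for all $u\in U$, and for all $F_1,F_2\in\mathcal F$ the set $F_1\cap F_2$ is one of $\emptyset,F_1,F_2$. The laminar tree of a laminar set system is the rooted tree whose nodes correspond bijectively to the sets in $\mathcal F$, where the node of $F$ is a descendant of the node of $F'$ iff $F\subseteq F'$. The down-degree of a rooted tree is the maximum number of children of a node. -}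

module Defs where

open import Data.Bool using (Bool; T)
open import Data.Fin using (Fin)
open import Data.Fin.Subset using (Subset; Nonempty; _∈_; _⊆_; _∩_; ⊤; ⊥; ⁅_⁆)
open import Data.Nat using (ℕ; suc; _≤_; _⊔_; NonZero)
open import Data.Product using (∃; _×_)
open import Data.Sum using (_⊎_)
open import Data.Vec using (Vec; []; _∷_; lookup)
open import Data.Vec.Functional using (foldr)
open import Function.Bundles using (_⇔_)
open import Relation.Binary.PropositionalEquality using (_≡_)
open import Relation.Nullary using (¬_)

-- The universe is Fin size.  The family is Bool-valued so that every formula
-- below has a decidable, hence classical, truth value.
record SetSystem : Set where
  field
    size              : ℕ
    universe-nonempty : NonZero size
    family            : Subset size → Bool

  SET : Subset size → Set
  SET X = T (family X)

  field
    members-nonempty : ∀ X → SET X → Nonempty X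

open SetSystem public using (size; SET)

record Laminar (S : SetSystem) : Set where
  field
    universe   : SET S ⊤
    singletons : ∀ u → SET S ⁅ u ⁆
    crossing   : ∀ F₁ F₂ → SET S F₁ → SET S F₂ →
                 F₁ ∩ F₂ ≡ ⊥ ⊎ F₁ ∩ F₂ ≡ F₁ ⊎ F₁ ∩ F₂ ≡ F₂

-- Finite rooted trees, given by the subtrees at the children of the root.
data RootedTree : Set where
  node : (d : ℕ) → (Fin d → RootedTree) → RootedTree

downDegree : RootedTree → ℕ
downDegree (node d c) = d ⊔ foldr _⊔_ 0 (λ i → downDegree (c i))

data Node : RootedTree → Set where
  root  : ∀ {d c} → Node (node d c)
  below : ∀ {d c} (i : Fin d) → Node (c i) → Node (node d c)

infix 4 _⊑_

-- u ⊑ v: u is a descendant of v; every node is a descendant of itself.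
data _⊑_ : ∀ {t} → Node t → Node t → Set where
  ⊑-root  : ∀ {d c} {u : Node (node d c)} → u ⊑ root
  ⊑-below : ∀ {d} {c : Fin d → RootedTree} {i} {u v : Node (c i)} →
            u ⊑ v → below {c = c} i u ⊑ below i v

record IsLaminarTree (S : SetSystem) (t : RootedTree) : Set where
  field
    set        : Node t → Subset (size S)
    set-SET    : ∀ v → SET S (set v)
    injective  : ∀ u v → set u ≡ set v → u ≡ v
    surjective : ∀ F → SET S F → ∃ λ v → set v ≡ F
    descendant : ∀ u v → (u ⊑ v) ⇔ (set u ⊆ set v)

𝓛 : ℕ → SetSystem → Set
𝓛 k S = Laminar S × ∃ λ t → IsLaminarTree S t × downDegree t ≤ k

infix  8 _≐_ _∈̇_
infix  7 ¬ᶠ_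
infixr 6 _∧ᶠ_
infixr 5 _∨ᶠ_
infixr 4 _⇒ᶠ_

-- MSO formulas over {SET} with e free element variables and s free set
-- variables, both as de Bruijn indices: a quantifier binds index zero of its
-- own sort.
data MSO (e s : ℕ) : Set where
  _≐_            : Fin e → Fin e → MSO e s
  _∈̇_            : Fin e → Fin s → MSO e s
  SETᶠ           : Fin s → MSO e s
  ¬ᶠ_            : MSO e s → MSO e s
  _∧ᶠ_ _∨ᶠ_ _⇒ᶠ_ : MSO e s → MSO e s → MSO e s
  ∃ᵉ ∀ᵉ          : MSO (suc e) s → MSO e s
  ∃ˢ ∀ˢ          : MSO e (suc s) → MSO e s

module _ (S : SetSystem) where

  Sat : ∀ {e s} → MSO e s → Vec (Fin (size S)) e → Vec (Subset (size S)) s → Set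
  Sat (x ≐ y)   ρ σ = lookup ρ x ≡ lookup ρ y
  Sat (x ∈̇ X)   ρ σ = lookup ρ x ∈ lookup σ X
  Sat (SETᶠ X)  ρ σ = SET S (lookup σ X)
  Sat (¬ᶠ φ)    ρ σ = ¬ Sat φ ρ σ
  Sat (φ ∧ᶠ ψ)  ρ σ = Sat φ ρ σ × Sat ψ ρ σ
  Sat (φ ∨ᶠ ψ)  ρ σ = Sat φ ρ σ ⊎ Sat ψ ρ σ
  Sat (φ ⇒ᶠ ψ)  ρ σ = Sat φ ρ σ → Sat ψ ρ σ
  Sat (∃ᵉ φ)    ρ σ = ∃ λ u → Sat φ (u ∷ ρ) σ
  Sat (∀ᵉ φ)    ρ σ = ∀ u → Sat φ (u ∷ ρ) σ
  Sat (∃ˢ φ)    ρ σ = ∃ λ Y → Sat φ ρ (Y ∷ σ)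
  Sat (∀ˢ φ)    ρ σ = ∀ Y → Sat φ ρ (Y ∷ σ)

infix 4 _⊨_[_]

_⊨_[_] : (S : SetSystem) → MSO 0 1 → Subset (size S) → Set
S ⊨ φ [ X ] = Sat S φ [] (X ∷ [])

{-# OPTIONS --safe #-}

-- A labelling of the laminar tree by the parities of ∣ X ∩ F ∣ is easily
-- verified locally, since a node has at most k children, but the labels of the
-- inner nodes have to be coded by sets of leaves.  A leaf set A gives every node
-- a bit, namely whether the player to move wins the game in which a token
-- descends from that node to some leaf u, where the player to move wins iff
-- u ∈ A.  The bit of an inner node is thus the NAND of the bits of its
-- children.  It is MSO-definable: a strategy is a subtree, hence a leaf set, and
-- whose turn it is can be read off from the branching of this subtree, as an
-- inner node has at least two children.  Four leaf sets suffice to code every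
-- parity labelling: a node of even label gets two of the four bits, one of odd
-- label three, and such bits can be chosen from the root downwards.

module Submission where

open import Data.Bool using (Bool; true; false; not; _∧_; _≟_; if_then_else_)
open import Data.Bool.Properties using (¬-not; not-¬)
open import Data.Fin using (Fin; zero; suc; punchIn)
import Data.Fin as Fin
open import Data.Fin.Patterns using (0F; 1F; 2F; 3F; 4F; 5F; 6F)
open import Data.Fin.Properties using (any?; punchInᵢ≢i)
open import Data.Fin.Subset using (Subset; Nonempty; _∈_; _∉_; _⊆_; _∩_; ∣_∣; ⁅_⁆; ⊤)
open import Data.Fin.Subset.Properties
  using (_∈?_; nonempty?; p⊆q⇒∣p∣≤∣q∣; ⊆-antisym; x∈p∩q⁺; x∈p∩q⁻; x∈⁅x⁆; x∈⁅y⁆⇒x≡y;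
         ∣⁅x⁆∣≡1; ∣⊥∣≡0; ∈⊤; Empty-unique)
open import Data.Nat using (ℕ; zero; suc; _+_; _*_; _≤_; z≤n; NonZero; parity; _⊔_)
open import Data.Nat.Divisibility using (_∣_; divides)
open import Data.Nat.Properties
  using (+-0-commutativeMonoid; +-identityʳ; ≤-pred; +-mono-≤; ≤-trans; ≤-reflexive;
         m≤m⊔n; m≤n⊔m)
open import Data.Parity as ℙ using (Parity; 0ℙ; 1ℙ)
open import Data.Parity.Properties using (+-homo-+; suc-homo-⁻¹) renaming (_≟_ to _≟ℙ_)
open import Data.Product using (∃; _×_; _,_; proj₁; proj₂)
open import Data.Product.Function.NonDependent.Propositional using (_×-⇔_)
open import Data.Sum using (_⊎_; inj₁; inj₂)
open import Data.Sum.Function.Propositional using (_⊎-⇔_)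
open import Data.Vec using (Vec; []; _∷_; lookup; tabulate)
open import Data.Vec.Functional using (foldr)
open import Data.Vec.Properties using ([]=⇒lookup; lookup⇒[]=; lookup∘tabulate)
open import Function using (_∘_; id)
open import Function.Bundles using (_⇔_; mk⇔; module Equivalence)
open import Function.Properties.Equivalence using () renaming (trans to ⇔-trans; sym to ⇔-sym)
open import Relation.Binary.PropositionalEquality
open import Relation.Nullary using (Dec; yes; no; ¬_; does; contradiction; _×-dec_; ¬?)
open import Relation.Nullary.Decidable using (dec-true; decidable-stable)
open import Defs

open Equivalence using (to; from)
open import Algebra.Properties.CommutativeMonoid.Sum +-0-commutativeMonoid
  using (sum; sum-syntax; sum-cong-≗; sum-replicate-zero; sum-remove; ∑-comm)
open ≡-Reasoning

-- Finite sets and cardinalities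

⟪_⟫ : ∀ {n} {P : Fin n → Set} → (∀ u → Dec (P u)) → Subset n
⟪ P? ⟫ = tabulate (does ∘ P?)

∈⟪⟫ : ∀ {n} {P : Fin n → Set} (P? : ∀ u → Dec (P u)) {u} → u ∈ ⟪ P? ⟫ ⇔ P u
∈⟪⟫ {P = P} P? {u} = mk⇔
  (λ m → sound (trans (sym (lookup∘tabulate (does ∘ P?) u)) ([]=⇒lookup m)))
  (λ p → lookup⇒[]= u _ (trans (lookup∘tabulate (does ∘ P?) u) (dec-true (P? u) p)))
  where
  sound : does (P? u) ≡ true → P u
  sound eq with yes p ← P? u = p

Disjoint : ∀ {n d} → (Fin d → Subset n) → Set
Disjoint c = ∀ {u i j} → u ∈ c i → u ∈ c j → i ≡ j

sum-zero : ∀ {n} (f : Fin n → ℕ) → (∀ i → f i ≡ 0) → sum f ≡ 0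
sum-zero {n} f f≡0 = trans (sum-cong-≗ f≡0) (sum-replicate-zero n)

sum-single : ∀ {n} (f : Fin n → ℕ) i → (∀ j → j ≢ i → f j ≡ 0) → sum f ≡ f i
sum-single {suc n} f i f≡0 = begin
  sum f                          ≡⟨ sum-remove {i = i} f ⟩
  f i + sum (f ∘ punchIn i)      ≡⟨ cong (f i +_) (sum-zero _ λ j → f≡0 _ (punchInᵢ≢i i j)) ⟩
  f i + 0                        ≡⟨ +-identityʳ (f i) ⟩
  f i                            ∎

sum≤n : ∀ {n} (f : Fin n → ℕ) → (∀ i → f i ≤ 1) → sum f ≤ n
sum≤n {zero}  f f≤1 = z≤n
sum≤n {suc n} f f≤1 = +-mono-≤ (f≤1 zero) (sum≤n (f ∘ suc) (f≤1 ∘ suc))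

parity-sum-cong : ∀ {n} (f g : Fin n → ℕ) → (∀ i → parity (f i) ≡ parity (g i)) →
                  parity (sum f) ≡ parity (sum g)
parity-sum-cong {zero}  f g f≡g = refl
parity-sum-cong {suc n} f g f≡g = begin
  parity (f zero + sum (f ∘ suc))              ≡⟨ +-homo-+ (f zero) _ ⟩
  parity (f zero) ℙ.+ parity (sum (f ∘ suc))   ≡⟨ cong₂ ℙ._+_ (f≡g zero) (parity-sum-cong (f ∘ suc) (g ∘ suc) (f≡g ∘ suc)) ⟩
  parity (g zero) ℙ.+ parity (sum (g ∘ suc))   ≡⟨ +-homo-+ (g zero) _ ⟨
  parity (g zero + sum (g ∘ suc))              ∎

odd-sum⇒odd-term : ∀ {n} (f : Fin n → ℕ) → parity (sum f) ≡ 1ℙ → ∃ λ i → parity (f i) ≡ 1ℙ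
odd-sum⇒odd-term {suc n} f odd with parity (f zero) in eq
... | 1ℙ = zero , eq
... | 0ℙ with i , odd-i ← odd-sum⇒odd-term (f ∘ suc)
                 (trans (sym (trans (+-homo-+ (f zero) _) (cong (ℙ._+ parity (sum (f ∘ suc))) eq))) odd) = suc i , odd-i

≢0ℙ⇒≡1ℙ : ∀ {p} → p ≢ 0ℙ → p ≡ 1ℙ
≢0ℙ⇒≡1ℙ {0ℙ} p≢0 = contradiction refl p≢0
≢0ℙ⇒≡1ℙ {1ℙ} _   = refl

≢1ℙ⇒≡0ℙ : ∀ {p} → p ≢ 1ℙ → p ≡ 0ℙ
≢1ℙ⇒≡0ℙ {0ℙ} _   = refl
≢1ℙ⇒≡0ℙ {1ℙ} p≢1 = contradiction refl p≢1

0ℙ≢1ℙ : 0ℙ ≢ 1ℙ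
0ℙ≢1ℙ ()

even-suc : ∀ n → parity (suc n) ≡ 0ℙ ⇔ parity n ≢ 0ℙ
even-suc n rewrite sym (suc-homo-⁻¹ n) with parity (suc n)
... | 0ℙ = mk⇔ (λ _ ()) (λ _ → refl)
... | 1ℙ = mk⇔ (λ ()) (λ p≢0 → contradiction refl p≢0)

2∣⇔parity≡0ℙ : ∀ n → 2 ∣ n ⇔ parity n ≡ 0ℙ
2∣⇔parity≡0ℙ n = mk⇔ (λ { (divides q refl) → even q }) (half n)
  where
  even : ∀ q → parity (q * 2) ≡ 0ℙ
  even zero    = refl
  even (suc q) = even q
  half : ∀ n → parity n ≡ 0ℙ → 2 ∣ n
  half zero          _ = divides 0 refl
  half (suc (suc n)) p with divides q eq ← half n p = divides (suc q) (cong (λ m → suc (suc m)) eq)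

indicator : Bool → ℕ
indicator b = if b then 1 else 0

∣p∣≡sum-indicator : ∀ {n} (p : Subset n) → ∣ p ∣ ≡ sum (indicator ∘ lookup p)
∣p∣≡sum-indicator []          = refl
∣p∣≡sum-indicator (true ∷ p)  = cong suc (∣p∣≡sum-indicator p)
∣p∣≡sum-indicator (false ∷ p) = ∣p∣≡sum-indicator p

x∈p⇒indicator≡1 : ∀ {n} {p : Subset n} {u} → u ∈ p → indicator (lookup p u) ≡ 1
x∈p⇒indicator≡1 u∈p rewrite []=⇒lookup u∈p = refl

x∉p⇒indicator≡0 : ∀ {n} {p : Subset n} {u} → u ∉ p → indicator (lookup p u) ≡ 0
x∉p⇒indicator≡0 {p = p} {u} u∉p with lookup p u in eq
... | false = refl
... | true  = contradiction (lookup⇒[]= u p eq) u∉p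

Empty⇒∣p∣≡0 : ∀ {n} {p : Subset n} → ¬ Nonempty p → ∣ p ∣ ≡ 0
Empty⇒∣p∣≡0 {n} empty = trans (cong ∣_∣ (Empty-unique empty)) (∣⊥∣≡0 n)

-- Double counting of the pairs of an element of `p` and a part containing it: covering and
-- disjointness make each element of `p` occur in exactly one pair.
∣p∣≡sum-parts : ∀ {n d} (p : Subset n) (c : Fin d → Subset n) →
                (∀ {u} → u ∈ p → ∃ λ j → u ∈ c j) → Disjoint c →
                ∣ p ∣ ≡ sum (λ j → ∣ p ∩ c j ∣)
∣p∣≡sum-parts {n} {d} p c cover disjoint = begin
  ∣ p ∣                                                   ≡⟨ ∣p∣≡sum-indicator p ⟩
  sum (indicator ∘ lookup p)                              ≡⟨ sum-cong-≗ pointwise ⟩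
  ∑[ u < n ] ∑[ j < d ] indicator (lookup (p ∩ c j) u)    ≡⟨ ∑-comm {n} {d} _ ⟩
  ∑[ j < d ] ∑[ u < n ] indicator (lookup (p ∩ c j) u)    ≡⟨ sum-cong-≗ (λ j → ∣p∣≡sum-indicator (p ∩ c j)) ⟨
  sum (λ j → ∣ p ∩ c j ∣)                                 ∎
  where
  pointwise : ∀ u → indicator (lookup p u) ≡ ∑[ j < d ] indicator (lookup (p ∩ c j) u)
  pointwise u with u ∈? p
  ... | no u∉p = trans (x∉p⇒indicator≡0 u∉p)
          (sym (sum-zero {d} _ λ j → x∉p⇒indicator≡0 (u∉p ∘ proj₁ ∘ x∈p∩q⁻ p (c j))))
  ... | yes u∈p with i , u∈cᵢ ← cover u∈p = begin
    indicator (lookup p u)                              ≡⟨ x∈p⇒indicator≡1 u∈p ⟩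
    1                                                   ≡⟨ x∈p⇒indicator≡1 (x∈p∩q⁺ (u∈p , u∈cᵢ)) ⟨
    indicator (lookup (p ∩ c i) u)                      ≡⟨ sum-single {d} _ i (λ j j≢i → x∉p⇒indicator≡0 λ m →
                                                             j≢i (disjoint (proj₂ (x∈p∩q⁻ p (c j) m)) u∈cᵢ)) ⟨
    ∑[ j < d ] indicator (lookup (p ∩ c j) u)           ∎

-- The two parts are `⁅ x ⁆` and `q`. The set `q` is given by its membership condition because this
-- is how `evenᶠ` describes the smaller set.
∣p∣≡1+∣p-x∣ : ∀ {n} {p q : Subset n} {x} → x ∈ p → (∀ y → y ∈ q ⇔ (y ∈ p × y ≢ x)) → ∣ p ∣ ≡ suc ∣ q ∣
∣p∣≡1+∣p-x∣ {n} {p} {q} {x} x∈p q⇔ = begin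
  ∣ p ∣                            ≡⟨ ∣p∣≡sum-parts p c cover disjoint ⟩
  ∣ p ∩ ⁅ x ⁆ ∣ + (∣ p ∩ q ∣ + 0)  ≡⟨ cong (∣ p ∩ ⁅ x ⁆ ∣ +_) (+-identityʳ _) ⟩
  ∣ p ∩ ⁅ x ⁆ ∣ + ∣ p ∩ q ∣        ≡⟨ cong₂ (λ r s → ∣ r ∣ + ∣ s ∣)
                                       (⊆-antisym (proj₂ ∘ x∈p∩q⁻ p ⁅ x ⁆) λ y∈ → x∈p∩q⁺ (subst (_∈ p) (sym (x∈⁅y⁆⇒x≡y x y∈)) x∈p , y∈))
                                       (⊆-antisym (proj₂ ∘ x∈p∩q⁻ p q) λ y∈q → x∈p∩q⁺ (proj₁ (to (q⇔ _) y∈q) , y∈q)) ⟩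
  ∣ ⁅ x ⁆ ∣ + ∣ q ∣                ≡⟨ cong (_+ ∣ q ∣) (∣⁅x⁆∣≡1 x) ⟩
  suc ∣ q ∣                        ∎
  where
  c : Fin 2 → Subset n
  c zero       = ⁅ x ⁆
  c (suc zero) = q
  cover : ∀ {y} → y ∈ p → ∃ λ j → y ∈ c j
  cover {y} y∈p with y Fin.≟ x
  ... | yes refl = zero , x∈⁅x⁆ x
  ... | no y≢x   = suc zero , from (q⇔ y) (y∈p , y≢x)
  disjoint : Disjoint c
  disjoint {_} {zero}     {zero}     _  _  = refl
  disjoint {_} {suc zero} {suc zero} _  _  = refl
  disjoint {_} {zero}     {suc zero} y∈ y∈q = contradiction (x∈⁅y⁆⇒x≡y x y∈) (proj₂ (to (q⇔ _) y∈q))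
  disjoint {_} {suc zero} {zero}     y∈q y∈ = contradiction (x∈⁅y⁆⇒x≡y x y∈) (proj₂ (to (q⇔ _) y∈q))

x∈p⇒1≤∣p∣ : ∀ {n} {p : Subset n} {x} → x ∈ p → 1 ≤ ∣ p ∣
x∈p⇒1≤∣p∣ {p = p} {x} x∈p = subst (_≤ ∣ p ∣) (∣⁅x⁆∣≡1 x)
  (p⊆q⇒∣p∣≤∣q∣ λ y∈ → subst (_∈ p) (sym (x∈⁅y⁆⇒x≡y x y∈)) x∈p)

-- Formulas

infix 4 _⇔ᶠ_

_⇔ᶠ_ : ∀ {e s} → MSO e s → MSO e s → MSO e s
φ ⇔ᶠ ψ = (φ ⇒ᶠ ψ) ∧ᶠ (ψ ⇒ᶠ φ)

module _ {e s : ℕ} where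

  subᶠ : Fin s → Fin s → MSO e s
  subᶠ X Y = ∀ᵉ (zero ∈̇ X ⇒ᶠ zero ∈̇ Y)

  meetsᶠ : Fin s → Fin s → MSO e s
  meetsᶠ X Y = ∃ᵉ (zero ∈̇ X ∧ᶠ zero ∈̇ Y)

  singᶠ : Fin e → Fin s → MSO e s
  singᶠ u F = u ∈̇ F ∧ᶠ ∀ᵉ (zero ∈̇ F ⇒ᶠ zero ≐ suc u)

-- The covering relation of inclusion on the family, which is the parent-child relation of the
-- laminar tree.
childᶠ : ∀ {e s} → Fin s → Fin s → MSO e s
childᶠ C F = SETᶠ C ∧ᶠ SETᶠ F ∧ᶠ subᶠ C F ∧ᶠ ¬ᶠ subᶠ F C ∧ᶠ
  ∀ˢ (SETᶠ zero ⇒ᶠ subᶠ (suc C) zero ⇒ᶠ subᶠ zero (suc F) ⇒ᶠ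
      subᶠ zero (suc C) ∨ᶠ subᶠ (suc F) zero)

-- A leaf set Y with playᶠ A Y F encodes the positions below F that can occur
-- when the winner of the game of A follows a winning strategy: in a position won
-- by the player to move some child is avoided, in a lost one no child is.
module _ {e s : ℕ} where

  wonᶠ : Fin s → Fin s → Fin s → MSO e s
  wonᶠ A Y G = ∃ᵉ (zero ∈̇ A ∧ᶠ singᶠ zero G) ∨ᶠ
               ∃ˢ (childᶠ zero (suc G) ∧ᶠ ¬ᶠ meetsᶠ (suc Y) zero)

playᶠ : ∀ {e s} → Fin s → Fin s → Fin s → MSO e s
playᶠ A Y F = ∀ˢ (∀ˢ (childᶠ 0F 1F ⇒ᶠ subᶠ 1F (↑ F) ⇒ᶠ meetsᶠ (↑ Y) 0F ⇒ᶠ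
                      (wonᶠ (↑ A) (↑ Y) 1F ⇔ᶠ ¬ᶠ wonᶠ (↑ A) (↑ Y) 0F)))
  where
  ↑ : ∀ {s} → Fin s → Fin (suc (suc s))
  ↑ X = suc (suc X)

valueᶠ : ∀ {e s} → Fin s → Fin s → MSO e s
valueᶠ A F = ∃ˢ (meetsᶠ 0F (suc F) ∧ᶠ playᶠ (suc A) 0F (suc F) ∧ᶠ wonᶠ (suc A) 0F (suc F))

-- The states used below have odd label iff they meet both {false} × Bool (A, B)
-- and {true} × Bool (C, D).
oddᶠ : ∀ {e s} → Fin s → Fin s → Fin s → Fin s → Fin s → MSO e s
oddᶠ A B C D F = (valueᶠ A F ∨ᶠ valueᶠ B F) ∧ᶠ (valueᶠ C F ∨ᶠ valueᶠ D F)

-- Says that ∣ R ∣ is even, provided that ∣ R ∣ ≤ m.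
evenᶠ : ∀ {e s} → ℕ → Fin s → MSO e s
evenᶠ zero    R = ∀ᵉ (¬ᶠ (zero ∈̇ R))
evenᶠ (suc m) R = ∀ᵉ (¬ᶠ (zero ∈̇ R)) ∨ᶠ
  ∃ˢ (∃ᵉ (0F ∈̇ suc R ∧ᶠ ∀ᵉ (0F ∈̇ zero ⇔ᶠ 0F ∈̇ suc R ∧ᶠ ¬ᶠ (0F ≐ 1F))) ∧ᶠ ¬ᶠ evenᶠ m zero)

singletonMeetᶠ : ∀ {e s} → Fin s → Fin s → MSO e s
singletonMeetᶠ R C = ∃ᵉ (0F ∈̇ R ∧ᶠ 0F ∈̇ C ∧ᶠ ∀ᵉ (0F ∈̇ R ⇒ᶠ 0F ∈̇ C ⇒ᶠ 0F ≐ 1F))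

-- The set variables of transversalᶠ stand for R, F, the four coding sets, X;
-- those of leafᶠ, innerᶠ and rootᶠ for F, the four coding sets, X.
transversalᶠ : MSO 0 7
transversalᶠ = subᶠ 0F 1F ∧ᶠ
  ∀ˢ (childᶠ 0F 2F ⇒ᶠ
      (oddᶠ 3F 4F 5F 6F 0F ⇒ᶠ singletonMeetᶠ 1F 0F) ∧ᶠ
      (¬ᶠ oddᶠ 3F 4F 5F 6F 0F ⇒ᶠ ¬ᶠ meetsᶠ 1F 0F))

leafᶠ : MSO 0 6
leafᶠ = ∀ᵉ (singᶠ 0F 0F ⇒ᶠ (oddᶠ 1F 2F 3F 4F 0F ⇔ᶠ 0F ∈̇ 5F))

innerᶠ : ℕ → MSO 0 6
innerᶠ k = ∃ˢ (childᶠ 0F 1F) ⇒ᶠ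
  ∃ˢ (transversalᶠ ∧ᶠ (oddᶠ 2F 3F 4F 5F 1F ⇔ᶠ ¬ᶠ evenᶠ k 0F))

rootᶠ : MSO 0 6
rootᶠ = ∀ᵉ (0F ∈̇ 0F) ⇒ᶠ ¬ᶠ oddᶠ 1F 2F 3F 4F 0F

evenCardᶠ : ℕ → MSO 0 1
evenCardᶠ k = ∃ˢ (∃ˢ (∃ˢ (∃ˢ (∀ˢ (SETᶠ 0F ⇒ᶠ leafᶠ ∧ᶠ innerᶠ k ∧ᶠ rootᶠ)))))

-- States

-- A state is a subset of Bool × Bool: evenˢ h is {h} × Bool, and oddˢ h e is the
-- complement of {(h , e)}.
data State : Set where
  evenˢ : Bool → State
  oddˢ  : Bool → Bool → State

holds : Bool → Bool → State → Bool
holds a b (evenˢ h)  = does (a ≟ h)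
holds a b (oddˢ h e) = not (does (a ≟ h) ∧ does (b ≟ e))

label : State → Parity
label (evenˢ _)  = 0ℙ
label (oddˢ _ _) = 1ℙ

label≡1ℙ⇔ : ∀ s → ((holds false false s ≡ true ⊎ holds false true s ≡ true) ×
                   (holds true false s ≡ true ⊎ holds true true s ≡ true)) ⇔ label s ≡ 1ℙ
label≡1ℙ⇔ (evenˢ false)      = mk⇔ (λ { (_ , inj₁ ()) ; (_ , inj₂ ()) }) λ ()
label≡1ℙ⇔ (evenˢ true)       = mk⇔ (λ { (inj₁ () , _) ; (inj₂ () , _) }) λ ()
label≡1ℙ⇔ (oddˢ false false) = mk⇔ (λ _ → refl) λ _ → inj₂ refl , inj₁ refl
label≡1ℙ⇔ (oddˢ false true)  = mk⇔ (λ _ → refl) λ _ → inj₁ refl , inj₁ refl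
label≡1ℙ⇔ (oddˢ true false)  = mk⇔ (λ _ → refl) λ _ → inj₁ refl , inj₂ refl
label≡1ℙ⇔ (oddˢ true true)   = mk⇔ (λ _ → refl) λ _ → inj₁ refl , inj₁ refl

-- With states read as subsets of `Bool × Bool`, `s` is the union of the complements of the `σ j`;
-- this is the NAND rule for all four games at once.
NandOf : ∀ {d} → State → (Fin d → State) → Set
NandOf s σ = ∀ a b → holds a b s ≡ true ⇔ ∃ λ j → holds a b (σ j) ≡ false

-- The complement of inHalf h e p lies in {h} × Bool and contains (h , e); that of
-- offHalf h e p lies in oddˢ h e.
inHalf : Bool → Bool → Parity → State
inHalf h e 0ℙ = evenˢ (not h)
inHalf h e 1ℙ = oddˢ h e

label-inHalf : ∀ h e p → label (inHalf h e p) ≡ p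
label-inHalf h e 0ℙ = refl
label-inHalf h e 1ℙ = refl

inHalf-sound : ∀ a b h e p → holds a b (inHalf h e p) ≡ false → holds a b (evenˢ h) ≡ true
inHalf-sound false b false e p  _ = refl
inHalf-sound true  b true  e p  _ = refl
inHalf-sound false b true  e 0ℙ ()
inHalf-sound false b true  e 1ℙ ()
inHalf-sound true  b false e 0ℙ ()
inHalf-sound true  b false e 1ℙ ()

inHalf-hit : ∀ a b h p → holds a b (evenˢ h) ≡ true → holds a b (inHalf h b p) ≡ false
inHalf-hit false b     false 0ℙ _ = refl
inHalf-hit true  b     true  0ℙ _ = refl
inHalf-hit false false false 1ℙ _ = refl
inHalf-hit false true  false 1ℙ _ = refl
inHalf-hit true  false true  1ℙ _ = refl
inHalf-hit true  true  true  1ℙ _ = refl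

-- The complements have to cover both points of the half `h`: the first child is made to cover
-- `(h , false)` and all others `(h , true)`, so two children are enough whatever their labels.
evenStates : ∀ {d} → Bool → (Fin (suc (suc d)) → ℕ) → Fin (suc (suc d)) → State
evenStates h m zero    = inHalf h false (parity (m zero))
evenStates h m (suc j) = inHalf h true (parity (m (suc j)))

label-evenStates : ∀ {d} h (m : Fin (suc (suc d)) → ℕ) j → label (evenStates h m j) ≡ parity (m j)
label-evenStates h m zero    = label-inHalf h false (parity (m zero))
label-evenStates h m (suc j) = label-inHalf h true (parity (m (suc j)))

evenStates-nand : ∀ {d} h (m : Fin (suc (suc d)) → ℕ) → NandOf (evenˢ h) (evenStates h m)
evenStates-nand h m a b = mk⇔ (⇒ b) ⇐
  where
  ⇒ : ∀ b → holds a b (evenˢ h) ≡ true → ∃ λ j → holds a b (evenStates h m j) ≡ false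
  ⇒ false p = zero , inHalf-hit a false h (parity (m zero)) p
  ⇒ true  p = suc zero , inHalf-hit a true h (parity (m (suc zero))) p
  ⇐ : (∃ λ j → holds a b (evenStates h m j) ≡ false) → holds a b (evenˢ h) ≡ true
  ⇐ (zero  , p) = inHalf-sound a b h false (parity (m zero)) p
  ⇐ (suc j , p) = inHalf-sound a b h true (parity (m (suc j))) p

offHalf : Bool → Bool → Parity → State
offHalf h e 0ℙ = evenˢ h
offHalf h e 1ℙ = oddˢ h (not e)

label-offHalf : ∀ h e p → label (offHalf h e p) ≡ p
label-offHalf h e 0ℙ = refl
label-offHalf h e 1ℙ = refl

offHalf-sound : ∀ a b h e p → holds a b (offHalf h e p) ≡ false → holds a b (oddˢ h e) ≡ true
offHalf-sound false b     true  e     p  _ = refl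
offHalf-sound true  b     false e     p  _ = refl
offHalf-sound false b     false e     0ℙ ()
offHalf-sound true  b     true  e     0ℙ ()
offHalf-sound false false false true  1ℙ _ = refl
offHalf-sound false true  false false 1ℙ _ = refl
offHalf-sound true  false true  true  1ℙ _ = refl
offHalf-sound true  true  true  false 1ℙ _ = refl

odd-split : ∀ a b h e → holds a b (oddˢ h e) ≡ true →
            holds a b (oddˢ h (not e)) ≡ false ⊎ holds a b (evenˢ (not h)) ≡ true
odd-split false b     true  e     _ = inj₂ refl
odd-split true  b     false e     _ = inj₂ refl
odd-split false false false true  _ = inj₁ refl
odd-split false true  false false _ = inj₁ refl
odd-split true  false true  true  _ = inj₁ refl
odd-split true  true  true  false _ = inj₁ refl

otherHalf : ∀ a h → does (a ≟ not h) ≡ true → does (a ≟ h) ≡ false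
otherHalf false true  _ = refl
otherHalf true  false _ = refl

otherHalf-odd : ∀ a b h e → does (a ≟ not h) ≡ true → holds a b (oddˢ h e) ≡ true
otherHalf-odd a b h e p = cong (λ x → not (x ∧ _)) (otherHalf a h p)

offHalf-nand : ∀ {d} h e (m : Fin d → ℕ) {i j} → parity (m i) ≡ 0ℙ → parity (m j) ≡ 1ℙ →
               NandOf (oddˢ h e) (λ l → offHalf h e (parity (m l)))
offHalf-nand h e m {i} {j} mᵢ mⱼ a b = mk⇔ ⇒ λ (l , p) → offHalf-sound a b h e (parity (m l)) p
  where
  ⇒ : holds a b (oddˢ h e) ≡ true → ∃ λ l → holds a b (offHalf h e (parity (m l))) ≡ false
  ⇒ p with odd-split a b h e p
  ... | inj₁ q = j , trans (cong (λ x → holds a b (offHalf h e x)) mⱼ) q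
  ... | inj₂ q = i , trans (cong (λ x → holds a b (offHalf h e x)) mᵢ) (otherHalf a h q)

-- For an odd state the complements must cover `(h , not e)` and the other half while avoiding
-- `(h , e)`. In `offHalf` an odd child covers the former and an even child the latter, so the
-- problem is how to proceed when no child is even.
childStates : ∀ {d} s (m : Fin (suc (suc d)) → ℕ) → label s ≡ parity (sum m) →
              ∃ λ σ → (∀ j → label (σ j) ≡ parity (m j)) × NandOf s σ
childStates (evenˢ h) m _ = evenStates h m , label-evenStates h m , evenStates-nand h m
childStates {d} (oddˢ h e) m p with parity (m zero) in m₀
-- The first child is even, and an odd sum supplies an odd one.
... | 0ℙ = (λ j → offHalf h e (parity (m j))) , (λ j → label-offHalf h e _) ,
           offHalf-nand h e m m₀ (proj₂ (odd-sum⇒odd-term m (sym p)))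
-- Of two children with odd sum, the first being odd, the second is even.
childStates {zero} (oddˢ h e) m p | 1ℙ =
  (λ j → offHalf h e (parity (m j))) , (λ j → label-offHalf h e _) ,
  offHalf-nand h e m {suc zero} {zero} m₁ m₀
  where
  m₁ : parity (m (suc zero)) ≡ 0ℙ
  m₁ with parity (m (suc zero)) in eq
  ... | 0ℙ = refl
  ... | 1ℙ with () ← begin
    1ℙ                                                 ≡⟨ p ⟩
    parity (sum m)                                     ≡⟨ +-homo-+ (m zero) _ ⟩
    parity (m zero) ℙ.+ parity (m (suc zero) + 0)      ≡⟨ cong (parity (m zero) ℙ.+_) (+-homo-+ (m (suc zero)) 0) ⟩
    parity (m zero) ℙ.+ (parity (m (suc zero)) ℙ.+ 0ℙ) ≡⟨ cong₂ (λ x y → x ℙ.+ (y ℙ.+ 0ℙ)) m₀ eq ⟩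
    0ℙ                                                 ∎
-- The first child covers `(h , not e)`; at least two remain, and these cover the other half as if
-- below an even state, even if all of them are odd.
childStates {suc d} (oddˢ h e) m p | 1ℙ = σ , labels , λ a b → mk⇔ (⇒ a b) (⇐ a b)
  where
  σ : Fin (suc (suc (suc d))) → State
  σ zero    = oddˢ h (not e)
  σ (suc j) = evenStates (not h) (m ∘ suc) j
  labels : ∀ j → label (σ j) ≡ parity (m j)
  labels zero    = sym m₀
  labels (suc j) = label-evenStates (not h) (m ∘ suc) j
  ⇒ : ∀ a b → holds a b (oddˢ h e) ≡ true → ∃ λ j → holds a b (σ j) ≡ false
  ⇒ a b q with odd-split a b h e q
  ... | inj₁ r = zero , r
  ... | inj₂ r with j , t ← to (evenStates-nand (not h) (m ∘ suc) a b) r = suc j , t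
  ⇐ : ∀ a b → (∃ λ j → holds a b (σ j) ≡ false) → holds a b (oddˢ h e) ≡ true
  ⇐ a b (zero  , q) = offHalf-sound a b h e 1ℙ q
  ⇐ a b (suc j , q) = otherHalf-odd a b h e (from (evenStates-nand (not h) (m ∘ suc) a b) (j , q))

-- Rooted trees

rootOf : ∀ t → Node t
rootOf (node d c) = root

⊑-rootOf : ∀ {t} (v : Node t) → v ⊑ rootOf t
⊑-rootOf {node d c} v = ⊑-root

below-injective : ∀ {d} {c : Fin d → RootedTree} {i} {u v : Node (c i)} →
                  below {c = c} i u ⊑ below i v → u ⊑ v
below-injective (⊑-below u⊑v) = u⊑v

below-inversion : ∀ {d} {c : Fin d → RootedTree} {i} {u : Node (node d c)} {v : Node (c i)} →
                  u ⊑ below i v → ∃ λ w → u ≡ below i w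
below-inversion (⊑-below _) = _ , refl

below-unique : ∀ {d} {c : Fin d → RootedTree} {u : Node (node d c)} {i j} {v : Node (c i)} {w : Node (c j)} →
               u ⊑ below i v → u ⊑ below j w → i ≡ j
below-unique (⊑-below _) (⊑-below _) = refl

lookup≤foldr-⊔ : ∀ {d} (f : Fin d → ℕ) j → f j ≤ foldr _⊔_ 0 f
lookup≤foldr-⊔ f zero    = m≤m⊔n (f zero) _
lookup≤foldr-⊔ f (suc j) = ≤-trans (lookup≤foldr-⊔ (f ∘ suc) j) (m≤n⊔m (f zero) _)

-- Semantics of the formulas

module Semantics (S : SetSystem) where

  n : ℕ
  n = size S

  -- Satisfaction of these formulas unfolds to the same type at any indices and valuations that
  -- yield the same sets and elements, so the small contexts chosen here serve everywhere.
  Sub Meets Child : Subset n → Subset n → Set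
  Sub   X Y = Sat S (subᶠ 0F 1F) [] (X ∷ Y ∷ [])
  Meets X Y = Sat S (meetsᶠ 0F 1F) [] (X ∷ Y ∷ [])
  Child C F = Sat S (childᶠ 0F 1F) [] (C ∷ F ∷ [])

  Sing : Fin n → Subset n → Set
  Sing u F = Sat S (singᶠ 0F 0F) (u ∷ []) (F ∷ [])

  Won Play : Subset n → Subset n → Subset n → Set
  Won  A Y G = Sat S (wonᶠ 0F 1F 2F) [] (A ∷ Y ∷ G ∷ [])
  Play A Y F = Sat S (playᶠ 0F 1F 2F) [] (A ∷ Y ∷ F ∷ [])

  Value : Subset n → Subset n → Set
  Value A F = Sat S (valueᶠ 0F 1F) [] (A ∷ F ∷ [])

  Odd : (Bool → Bool → Subset n) → Subset n → Set
  Odd A F = Sat S (oddᶠ 0F 1F 2F 3F 4F) []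
    (A false false ∷ A false true ∷ A true false ∷ A true true ∷ F ∷ [])

  Sub⇒⊆ : ∀ {X Y} → Sub X Y → X ⊆ Y
  Sub⇒⊆ X⊆Y = X⊆Y _

  Sub-antisym : ∀ {X Y} → Sub X Y → Sub Y X → X ≡ Y
  Sub-antisym {X} {Y} p q = ⊆-antisym (Sub⇒⊆ {X} {Y} p) (Sub⇒⊆ {Y} {X} q)

  meets? : ∀ X Y → Dec (Meets X Y)
  meets? X Y = any? λ u → u ∈? X ×-dec u ∈? Y

  SET-nonempty : ∀ {F} → SET S F → Nonempty F
  SET-nonempty {F} = SetSystem.members-nonempty S F

  Sing⇒≡⁅⁆ : ∀ {u F} → Sing u F → F ≡ ⁅ u ⁆
  Sing⇒≡⁅⁆ {u} {F} (u∈F , only) = ⊆-antisym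
    (λ {v} v∈F → subst (_∈ ⁅ u ⁆) (sym (only v v∈F)) (x∈⁅x⁆ u))
    (λ v∈ → subst (_∈ F) (sym (x∈⁅y⁆⇒x≡y u v∈)) u∈F)

  Sub-Sing : ∀ {u F G} → Sing u F → SET S G → Sub G F → G ≡ F
  Sub-Sing {F = F} {G} (u∈F , only) setG G⊆F with v , v∈G ← SET-nonempty setG =
    Sub-antisym {G} {F} G⊆F λ w w∈F →
      subst (_∈ G) (trans (only v (G⊆F v v∈G)) (sym (only w w∈F))) v∈G

  Sing-childless : ∀ {u F C} → Sing u F → ¬ Child C F
  Sing-childless {F = F} {C} s (setC , _ , C⊆F , F⊈C , _) =
    F⊈C (subst (Sub F) (sym (Sub-Sing {G = C} s setC C⊆F)) (λ _ → id))

  -- Trees of sets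

  record Branching (F : Subset n) {d} (c : Fin d → Subset n) : Set where
    field
      child    : ∀ j → Child (c j) F
      split    : ∀ G → SET S G → Sub G F → G ≡ F ⊎ ∃ λ j → Sub G (c j)
      cover    : ∀ {u} → u ∈ F → ∃ λ j → u ∈ c j
      disjoint : Disjoint c

    c⊆F : ∀ j → Sub (c j) F
    c⊆F j = proj₁ (proj₂ (proj₂ (child j)))

    member : ∀ j → Nonempty (c j)
    member j = SET-nonempty (proj₁ (child j))

    only : ∀ C → Child C F → ∃ λ j → C ≡ c j
    only C (setC , _ , C⊆F , F⊈C , maximal) with split C setC C⊆F
    ... | inj₁ refl = contradiction (λ _ → id) F⊈C
    ... | inj₂ (j , C⊆cⱼ) with maximal (c j) (proj₁ (child j)) C⊆cⱼ (c⊆F j)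
    ...   | inj₁ cⱼ⊆C = j , Sub-antisym {C} {c j} C⊆cⱼ cⱼ⊆C
    ...   | inj₂ F⊆cⱼ = contradiction F⊆cⱼ (proj₁ (proj₂ (proj₂ (proj₂ (child j)))))

  -- The laminar tree, indexed by sets instead of nodes. One-child nodes are excluded by
  -- construction, since both the encoding of plays and the choice of states rely on a second child.
  data Tree (k : ℕ) : Subset n → Set where
    leaf  : ∀ {F} u → Sing u F → Tree k F
    inner : ∀ {F d} (c : Fin (suc (suc d)) → Subset n) → Branching F c →
            suc (suc d) ≤ k → (∀ j → Tree k (c j)) → Tree k F

  -- The game and its plays

  Win : ∀ {k F} → Subset n → Tree k F → Set
  Win A (leaf u _)       = u ∈ A
  Win A (inner c _ _ ts) = ∃ λ j → ¬ Win A (ts j)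

  win? : ∀ {k F} A (t : Tree k F) → Dec (Win A t)
  win? A (leaf u _)       = u ∈? A
  win? A (inner c _ _ ts) = any? λ j → ¬? (win? A (ts j))

  play-mono : ∀ A Y {F G} → Sub G F → Play A Y F → Play A Y G
  play-mono A Y G⊆F play H C ch H⊆G = play H C ch λ u u∈H → G⊆F u (H⊆G u u∈H)

  -- By induction on the tree. At an inner node `Y` meets some child, and if the node counts as won,
  -- `playᶠ` makes that child lost. Conversely, a lost child either is met by `Y`, and then `playᶠ`
  -- makes the node won, or is missed, and then it is itself the witness for `wonᶠ`.
  won⇔win : ∀ {k F} A Y (t : Tree k F) → Meets Y F → Play A Y F → Won A Y F ⇔ Win A t
  won⇔win A Y (leaf u s) m play = mk⇔
    (λ { (inj₁ (v , v∈A , v∈F , _)) → subst (_∈ A) (proj₂ s v v∈F) v∈A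
       ; (inj₂ (C , ch , _)) → contradiction ch (Sing-childless s) })
    (λ u∈A → inj₁ (u , u∈A , s))
  won⇔win {F = F} A Y (inner c br _ ts) (u , u∈Y , u∈F) play = mk⇔ ⇒ ⇐
    where
    open Branching br
    ih : ∀ j → Meets Y (c j) → Won A Y (c j) ⇔ Win A (ts j)
    ih j m = won⇔win A Y (ts j) m (play-mono A Y {F} {c j} (c⊆F j) play)
    step : ∀ j → Meets Y (c j) → (Won A Y F → ¬ Won A Y (c j)) × (¬ Won A Y (c j) → Won A Y F)
    step j = play F (c j) (child j) (λ _ → id)
    ⇒ : Won A Y F → ∃ λ j → ¬ Win A (ts j)
    ⇒ won with i , u∈cᵢ ← cover u∈F =
      i , proj₁ (step i (u , u∈Y , u∈cᵢ)) won ∘ from (ih i (u , u∈Y , u∈cᵢ))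
    ⇐ : (∃ λ j → ¬ Win A (ts j)) → Won A Y F
    ⇐ (j , lose) with meets? Y (c j)
    ... | yes m = proj₂ (step j m) (lose ∘ to (ih j m))
    ... | no ¬m = inj₂ (c j , child j , ¬m)

  Agree : Subset n → Subset n → Subset n → Set
  Agree Y Z F = ∀ {u} → u ∈ F → u ∈ Y ⇔ u ∈ Z

  meets-agree : ∀ {Y Z F G} → Agree Y Z F → Sub G F → Meets Y G → Meets Z G
  meets-agree agree G⊆F (u , u∈Y , u∈G) = u , to (agree (G⊆F u u∈G)) u∈Y , u∈G

  agree-sym : ∀ {Y Z F} → Agree Y Z F → Agree Z Y F
  agree-sym agree u∈F = ⇔-sym (agree u∈F)

  won-agree : ∀ A {Y Z F G} → Agree Y Z F → Sub G F → Won A Y G → Won A Z G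
  won-agree A agree G⊆F (inj₁ w) = inj₁ w
  won-agree A {Y} {Z} {F} agree G⊆F (inj₂ (C , ch , ¬m)) =
    inj₂ (C , ch , λ m → ¬m (meets-agree {Z} {Y} {F} {C} (agree-sym {Y} {Z} {F} agree)
      (λ u u∈C → G⊆F u (proj₁ (proj₂ (proj₂ ch)) u u∈C)) m))

  -- Only the trace of `Y` on `F` matters, which allows plays chosen separately in the children to
  -- be glued.
  play-agree : ∀ A {Y Z F} → Agree Y Z F → Play A Y F → Play A Z F
  play-agree A {Y} {Z} {F} agree play G C ch G⊆F m = there′ , back
    where
    disagree = agree-sym {Y} {Z} {F} agree
    C⊆F : Sub C F
    C⊆F u u∈C = G⊆F u (proj₁ (proj₂ (proj₂ ch)) u u∈C)
    p = play G C ch G⊆F (meets-agree {Z} {Y} {F} {C} disagree C⊆F m)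
    there′ : Won A Z G → ¬ Won A Z C
    there′ wG wC = proj₁ p (won-agree A disagree G⊆F wG) (won-agree A disagree C⊆F wC)
    back : ¬ Won A Z C → Won A Z G
    back lC = won-agree A agree G⊆F (proj₂ p (lC ∘ won-agree A agree C⊆F))

  play-inner : ∀ {F d} {c : Fin d → Subset n} A Y → Branching F c →
               (∀ j → Play A Y (c j)) →
               (∀ j → Meets Y (c j) → (Won A Y F → ¬ Won A Y (c j)) × (¬ Won A Y (c j) → Won A Y F)) →
               Play A Y F
  play-inner {F} {c = c} A Y br plays step G C ch G⊆F m with Branching.split br G (proj₁ (proj₂ ch)) G⊆F
  ... | inj₂ (j , G⊆cⱼ) = plays j G C ch G⊆cⱼ m
  ... | inj₁ refl with j , refl ← Branching.only br C ch = step j m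

  play-missed : ∀ A Y {F} → ¬ Meets Y F → Play A Y F
  play-missed A Y ¬m G C ch G⊆F (u , u∈Y , u∈C) =
    contradiction (u , u∈Y , G⊆F u (proj₁ (proj₂ (proj₂ ch)) u u∈C)) ¬m

  another : ∀ {d} (i : Fin (suc (suc d))) → ∃ λ j → j ≢ i
  another zero    = suc zero , λ ()
  another (suc i) = zero , λ ()

  -- The play follows the winner: at a won node it keeps one lost child, at a lost node it has to
  -- keep every child.
  play-exists : ∀ {k F} A (t : Tree k F) → ∃ λ Y → Sub Y F × Meets Y F × Play A Y F
  play-exists {F = F} A (leaf u s) =
    F , (λ _ → id) , (u , proj₁ s , proj₁ s) , λ G C ch G⊆F →
      contradiction (subst (Child C) (Sub-Sing {G = G} s (proj₁ (proj₂ ch)) G⊆F) ch) (Sing-childless {C = C} s)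
  play-exists {F = F} A (inner c br d≤k ts) with win? A (inner c br d≤k ts)
  ... | yes (i , lose) with Y , Y⊆c , Y∩c , play ← play-exists A (ts i) =
    Y , (λ u → c⊆F i u ∘ Y⊆c u) , (proj₁ Y∩c , proj₁ (proj₂ Y∩c) , c⊆F i _ (proj₂ (proj₂ Y∩c))) ,
    play-inner A Y br plays λ j m →
      (λ _ → subst (λ l → ¬ Won A Y (c l)) (sym (met j m)) lost) , λ _ → won
    where
    open Branching br
    met : ∀ j → Meets Y (c j) → j ≡ i
    met j (u , u∈Y , u∈cⱼ) = disjoint u∈cⱼ (Y⊆c u u∈Y)
    plays : ∀ j → Play A Y (c j)
    plays j with meets? Y (c j)
    ... | yes m rewrite met j m = play
    ... | no ¬m = play-missed A Y ¬m
    lost : ¬ Won A Y (c i)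
    lost = lose ∘ to (won⇔win A Y (ts i) Y∩c play)
    won : Won A Y F
    -- A second child exists and is missed by `Y`; this marks the node as won.
    won with j , j≢i ← another i = inj₂ (c j , child j , j≢i ∘ met j)
  ... | no ¬win = Y , Y⊆F , (u₀ , meet₀) ,
    play-inner A Y br plays λ j m →
      (λ won → contradiction won lost) , λ ¬won → contradiction (wons j) ¬won
    where
    open Branching br
    ih = λ j → play-exists A (ts j)
    Z = λ j → proj₁ (ih j)
    inZ? = λ u → any? λ j → u ∈? Z j
    -- The union of the plays of the children; by disjointness its trace on each child is the play
    -- of that child.
    Y = ⟪ inZ? ⟫
    Y⊆F : Sub Y F
    Y⊆F u u∈Y with j , u∈Z ← to (∈⟪⟫ inZ?) u∈Y = c⊆F j u (proj₁ (proj₂ (ih j)) u u∈Z)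
    agree : ∀ j → Agree (Z j) Y (c j)
    agree j {u} u∈cⱼ = mk⇔ (λ u∈Z → from (∈⟪⟫ inZ?) (j , u∈Z)) λ u∈Y →
      let l , u∈Z = to (∈⟪⟫ inZ?) u∈Y
      in subst (λ i → u ∈ Z i) (disjoint (proj₁ (proj₂ (ih l)) u u∈Z) u∈cⱼ) u∈Z
    meets : ∀ j → Meets Y (c j)
    meets j = meets-agree {Z j} {Y} {c j} {c j} (agree j) (λ _ → id) (proj₁ (proj₂ (proj₂ (ih j))))
    u₀ = proj₁ (meets zero)
    meet₀ = proj₁ (proj₂ (meets zero)) , c⊆F zero u₀ (proj₂ (proj₂ (meets zero)))
    plays : ∀ j → Play A Y (c j)
    plays j = play-agree A {Z j} (agree j) (proj₂ (proj₂ (proj₂ (ih j))))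
    wons : ∀ j → Won A Y (c j)
    wons j = from (won⇔win A Y (ts j) (meets j) (plays j))
      (decidable-stable (win? A (ts j)) λ lose → ¬win (j , lose))
    lost : ¬ Won A Y F
    lost (inj₁ (u , _ , s)) = Sing-childless s (child zero)
    lost (inj₂ (C , ch , ¬m)) with j , refl ← only C ch = ¬m (meets j)

  -- By `won⇔win` every admissible `Y` names the same winner, and `play-exists` supplies such a `Y`.
  value⇔win : ∀ {k F} A (t : Tree k F) → Value A F ⇔ Win A t
  value⇔win A t = mk⇔
    (λ { (Y , m , play , won) → to (won⇔win A Y t m play) won })
    (λ win → let Y , _ , m , play = play-exists A t in
             Y , m , play , from (won⇔win A Y t m play) win)

  odd⇔wins : ∀ {k F} (A : Bool → Bool → Subset n) (t : Tree k F) → Odd A F ⇔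
             ((Win (A false false) t ⊎ Win (A false true) t) ×
              (Win (A true false) t ⊎ Win (A true true) t))
  odd⇔wins A t = (v false false ⊎-⇔ v false true) ×-⇔ (v true false ⊎-⇔ v true true)
    where
    v = λ a b → value⇔win (A a b) t

  -- Parities and the choice of the leaf sets

  ∣F∣≡sum-children : ∀ {F d} {c : Fin d → Subset n} → Branching F c →
                     ∀ X → ∣ X ∩ F ∣ ≡ sum (λ j → ∣ X ∩ c j ∣)
  ∣F∣≡sum-children {F} {c = c} br X = trans
    (∣p∣≡sum-parts (X ∩ F) c (cover ∘ proj₂ ∘ x∈p∩q⁻ X F) disjoint)
    (sum-cong-≗ λ j → cong ∣_∣ (⊆-antisym (restrict j) (extend j)))
    where
    open Branching br
    restrict : ∀ j → (X ∩ F) ∩ c j ⊆ X ∩ c j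
    restrict j m with m₁ , m₂ ← x∈p∩q⁻ (X ∩ F) (c j) m =
      x∈p∩q⁺ (proj₁ (x∈p∩q⁻ X F m₁) , m₂)
    extend : ∀ j → X ∩ c j ⊆ (X ∩ F) ∩ c j
    extend j {u} m with m₁ , m₂ ← x∈p∩q⁻ X (c j) m = x∈p∩q⁺ (x∈p∩q⁺ (m₁ , c⊆F j u m₂) , m₂)

  leaf-parity : ∀ {u F} X → Sing u F → u ∈ X ⇔ parity ∣ X ∩ F ∣ ≡ 1ℙ
  leaf-parity {u} {F} X s with refl ← Sing⇒≡⁅⁆ {u} {F} s = mk⇔
    (λ u∈X → cong parity (trans (cong ∣_∣ (⊆-antisym (proj₂ ∘ x∈p∩q⁻ X ⁅ u ⁆)
      λ {v} v∈ → x∈p∩q⁺ (subst (_∈ X) (sym (x∈⁅y⁆⇒x≡y u v∈)) u∈X , v∈))) (∣⁅x⁆∣≡1 u)))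
    ⇐
    where
    ⇐ : parity ∣ X ∩ ⁅ u ⁆ ∣ ≡ 1ℙ → u ∈ X
    ⇐ p with u ∈? X
    ... | yes u∈X = u∈X
    ... | no u∉X with () ← trans (sym p) (cong parity (Empty⇒∣p∣≡0 λ (v , m) →
            let v∈X , v∈ = x∈p∩q⁻ X ⁅ u ⁆ m in u∉X (subst (_∈ X) (x∈⁅y⁆⇒x≡y u v∈) v∈X)))

  -- The sets `A` come after `a` and are constrained on `F` only, so the assignments of the children
  -- can be glued before `A` is given. The parent needs the first conclusion, the local checks need
  -- the second.
  Realizes : ∀ {k F} → Subset n → Tree k F → State → (Fin n → State) → Set
  Realizes {F = F} X t s a = ∀ A → (∀ h e {u} → u ∈ F → u ∈ A h e ⇔ holds h e (a u) ≡ true) →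
    (∀ h e → Win (A h e) t ⇔ holds h e s ≡ true) ×
    (∀ G → SET S G → Sub G F → Odd A G ⇔ parity ∣ X ∩ G ∣ ≡ 1ℙ)

  odd⇔label : ∀ {k F s A} X (t : Tree k F) → label s ≡ parity ∣ X ∩ F ∣ →
          (∀ h e → Win (A h e) t ⇔ holds h e s ≡ true) →
          Odd A F ⇔ parity ∣ X ∩ F ∣ ≡ 1ℙ
  odd⇔label {F = F} {s} {A} X t ℓ w = ⇔-trans (odd⇔wins A t) (⇔-trans
    ((w false false ⊎-⇔ w false true) ×-⇔ (w true false ⊎-⇔ w true true))
    (subst (λ p → _ ⇔ p ≡ 1ℙ) ℓ (label≡1ℙ⇔ s)))

  -- The state `s` is imposed from above; `childStates` turns it into states for the children, and
  -- at a leaf it becomes the assignment itself.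
  realize : ∀ {k F s} X (t : Tree k F) → label s ≡ parity ∣ X ∩ F ∣ → ∃ (Realizes X t s)
  realize {F = F} {s} X (leaf u sg) ℓ = (λ _ → s) , λ A code →
    (λ h e → code h e (proj₁ sg)) , λ G setG G⊆F →
      subst (λ G → Odd A G ⇔ parity ∣ X ∩ G ∣ ≡ 1ℙ) (sym (Sub-Sing {u} {F} {G} sg setG G⊆F))
        (odd⇔label {k = 0} {s = s} {A} X (leaf u sg) ℓ λ h e → code h e (proj₁ sg))
  realize {F = F} {s} X (inner {d = d} c br d≤k ts) ℓ = a , result
    where
    open Branching br
    σs = childStates s (λ j → ∣ X ∩ c j ∣) (trans ℓ (cong parity (∣F∣≡sum-children br X)))
    σ = proj₁ σs
    ih : ∀ j → ∃ (Realizes X (ts j) (σ j))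
    ih j = realize X (ts j) (proj₁ (proj₂ σs) j)
    part? = λ u → any? λ j → u ∈? c j
    a : Fin n → State
    a u with part? u
    ... | yes (j , _) = proj₁ (ih j) u
    -- A point outside all parts is outside `F`, where `Realizes` puts no constraint on `a`; `s` is
    -- an arbitrary default.
    ... | no _        = s
    a-part : ∀ j {u} → u ∈ c j → a u ≡ proj₁ (ih j) u
    a-part j {u} u∈cⱼ with part? u
    ... | yes (i , u∈cᵢ) = cong (λ l → proj₁ (ih l) u) (disjoint u∈cᵢ u∈cⱼ)
    ... | no ¬part = contradiction (j , u∈cⱼ) ¬part
    result : Realizes X (inner c br d≤k ts) s a
    result A code = wins , odds
      where
      rec = λ j → proj₂ (ih j) A λ h e {u} u∈cⱼ →
        subst (λ x → u ∈ A h e ⇔ holds h e x ≡ true) (a-part j u∈cⱼ) (code h e (c⊆F j u u∈cⱼ))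
      lose⇔ : ∀ h e j → (¬ Win (A h e) (ts j)) ⇔ holds h e (σ j) ≡ false
      lose⇔ h e j = mk⇔
        (λ lose → ¬-not (lose ∘ from (proj₁ (rec j) h e)))
        (λ eq win → not-¬ eq (to (proj₁ (rec j) h e) win))
      wins : ∀ h e → (∃ λ j → ¬ Win (A h e) (ts j)) ⇔ holds h e s ≡ true
      wins h e = mk⇔
        (λ (j , lose) → from (proj₂ (proj₂ σs) h e) (j , to (lose⇔ h e j) lose))
        (λ eq → let j , p = to (proj₂ (proj₂ σs) h e) eq in j , from (lose⇔ h e j) p)
      odds : ∀ G → SET S G → Sub G F → Odd A G ⇔ parity ∣ X ∩ G ∣ ≡ 1ℙ
      odds G setG G⊆F with split G setG G⊆F
      ... | inj₁ refl = odd⇔label {s = s} {A} X (inner c br d≤k ts) ℓ wins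
      ... | inj₂ (j , G⊆cⱼ) = proj₂ (rec j) G setG G⊆cⱼ

  -- Removing an element flips the parity and lowers the bound by one; at bound zero the set must be
  -- empty.
  even⇔ : ∀ m {e r} (ρ : Vec (Fin n) e) (σ : Vec (Subset n) r) R → ∣ lookup σ R ∣ ≤ m →
          Sat S (evenᶠ m R) ρ σ ⇔ parity ∣ lookup σ R ∣ ≡ 0ℙ
  even⇔ zero ρ σ R ≤0 = mk⇔
    (λ empty → cong parity (Empty⇒∣p∣≡0 λ (u , u∈R) → empty u u∈R))
    (λ _ u u∈R → contradiction (≤-trans (x∈p⇒1≤∣p∣ u∈R) ≤0) λ ())
  even⇔ (suc m) ρ σ R ≤1+m = mk⇔ ⇒ ⇐
    where
    P = lookup σ R
    ⇒ : Sat S (evenᶠ (suc m) R) ρ σ → parity ∣ P ∣ ≡ 0ℙ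
    ⇒ (inj₁ empty) = cong parity (Empty⇒∣p∣≡0 λ (u , u∈P) → empty u u∈P)
    ⇒ (inj₂ (Q , (u , u∈P , remove) , ¬even)) = subst (λ x → parity x ≡ 0ℙ) (sym eq)
      (from (even-suc ∣ Q ∣) (¬even ∘ from (even⇔ m ρ (Q ∷ σ) zero (≤-pred (subst (_≤ suc m) eq ≤1+m)))))
      where
      eq = ∣p∣≡1+∣p-x∣ u∈P λ v → mk⇔ (proj₁ (remove v)) (proj₂ (remove v))
    ⇐ : parity ∣ P ∣ ≡ 0ℙ → Sat S (evenᶠ (suc m) R) ρ σ
    ⇐ even with nonempty? P
    ... | no empty = inj₁ λ u u∈P → empty (u , u∈P)
    ... | yes (u , u∈P) = inj₂ (Q , (u , u∈P , λ v → to (∈⟪⟫ Q?) , from (∈⟪⟫ Q?)) ,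
        to (even-suc ∣ Q ∣) (subst (λ x → parity x ≡ 0ℙ) eq even) ∘
        to (even⇔ m ρ (Q ∷ σ) zero (≤-pred (subst (_≤ suc m) eq ≤1+m))))
      where
      Q? = λ v → v ∈? P ×-dec ¬? (v Fin.≟ u)
      Q = ⟪ Q? ⟫
      eq = ∣p∣≡1+∣p-x∣ u∈P λ v → ∈⟪⟫ Q?

  -- The local checks and their correctness

  module _ (A : Bool → Bool → Subset n) (X : Subset n) where

    coding : Vec (Subset n) 5
    coding = A false false ∷ A false true ∷ A true false ∷ A true true ∷ X ∷ []

    OddCorrect : Subset n → Set
    OddCorrect F = Odd A F ⇔ parity ∣ X ∩ F ∣ ≡ 1ℙ

    Transversal : Subset n → Subset n → Set
    Transversal R F = Sat S transversalᶠ [] (R ∷ F ∷ coding)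

    -- A transversal has one element in each odd child and none in an even child. Its cardinality is
    -- therefore the number of odd children, which is at most `d` and has the parity of the sum over
    -- all children.
    transversal-card : ∀ {F d} {c : Fin d → Subset n} R → Branching F c → (∀ j → OddCorrect (c j)) →
                       Transversal R F → ∣ R ∣ ≤ d × parity ∣ R ∣ ≡ parity ∣ X ∩ F ∣
    transversal-card {F} {d} {c} R br correct (R⊆F , meet) =
      subst (_≤ d) (sym ∣R∣≡) (sum≤n _ ≤1) , (begin
      parity ∣ R ∣                          ≡⟨ cong parity ∣R∣≡ ⟩
      parity (sum (λ j → ∣ R ∩ c j ∣))      ≡⟨ parity-sum-cong _ _ same ⟩
      parity (sum (λ j → ∣ X ∩ c j ∣))      ≡⟨ cong parity (∣F∣≡sum-children br X) ⟨
      parity ∣ X ∩ F ∣                      ∎)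
      where
      open Branching br
      ∣R∣≡ : ∣ R ∣ ≡ sum (λ j → ∣ R ∩ c j ∣)
      ∣R∣≡ = ∣p∣≡sum-parts R c (cover ∘ R⊆F _) disjoint
      part : ∀ j → (∣ R ∩ c j ∣ ≡ 1 × parity ∣ X ∩ c j ∣ ≡ 1ℙ) ⊎ (∣ R ∩ c j ∣ ≡ 0 × parity ∣ X ∩ c j ∣ ≡ 0ℙ)
      part j with parity ∣ X ∩ c j ∣ in eq
      ... | 0ℙ = inj₂ (Empty⇒∣p∣≡0 (λ (u , m) → proj₂ (meet (c j) (child j)) ¬odd (u , x∈p∩q⁻ R (c j) m)) , refl)
        where
        ¬odd : ¬ Odd A (c j)
        ¬odd odd with () ← trans (sym eq) (to (correct j) odd)
      ... | 1ℙ with u , u∈R , u∈c , unique ← proj₁ (meet (c j) (child j)) (from (correct j) eq) =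
        inj₁ (trans (cong ∣_∣ (Sing⇒≡⁅⁆ {u} {R ∩ c j} (x∈p∩q⁺ (u∈R , u∈c) , λ v m →
          unique v (proj₁ (x∈p∩q⁻ R (c j) m)) (proj₂ (x∈p∩q⁻ R (c j) m))))) (∣⁅x⁆∣≡1 u) , refl)
      ≤1 : ∀ j → ∣ R ∩ c j ∣ ≤ 1
      ≤1 j with part j
      ... | inj₁ (eq , _) = ≤-reflexive eq
      ... | inj₂ (eq , _) = subst (_≤ 1) (sym eq) z≤n
      same : ∀ j → parity ∣ R ∩ c j ∣ ≡ parity ∣ X ∩ c j ∣
      same j with part j
      ... | inj₁ (eq , p) = trans (cong parity eq) (sym p)
      ... | inj₂ (eq , p) = trans (cong parity eq) (sym p)

    -- One element is fixed in each child and retained if the child is odd; disjointness keeps it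
    -- out of the other children.
    transversal-exists : ∀ {F d} {c : Fin d → Subset n} → Branching F c → (∀ j → OddCorrect (c j)) →
                         ∃ λ R → Transversal R F
    transversal-exists {F} {c = c} br correct = R ,
      (λ u u∈R → let j , _ , eq = to (∈⟪⟫ R?) u∈R in subst (_∈ F) (sym eq) (c⊆F j _ (proj₂ (member j)))) ,
      meet
      where
      open Branching br
      pick = λ j → proj₁ (member j)
      R? = λ u → any? λ j → parity ∣ X ∩ c j ∣ ≟ℙ 1ℙ ×-dec u Fin.≟ pick j
      R = ⟪ R? ⟫
      inPart : ∀ j {u} → u ∈ R → u ∈ c j → parity ∣ X ∩ c j ∣ ≡ 1ℙ × u ≡ pick j
      inPart j u∈R u∈c with i , odd , refl ← to (∈⟪⟫ R?) u∈R
        with refl ← disjoint (proj₂ (member i)) u∈c = odd , refl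
      meet : ∀ C → Child C F → (Odd A C → Sat S (singletonMeetᶠ 0F 1F) [] (R ∷ C ∷ [])) × (¬ Odd A C → ¬ Meets R C)
      meet C ch with j , refl ← only C ch =
        (λ odd → pick j , from (∈⟪⟫ R?) (j , to (correct j) odd , refl) , proj₂ (member j) ,
           λ v v∈R v∈c → proj₂ (inPart j v∈R v∈c)) ,
        λ even (u , u∈R , u∈c) → even (from (correct j) (proj₁ (inPart j u∈R u∈c)))

    -- The bound on the down-degree enters here: `R` has at most `d ≤ k` elements, so `evenᶠ k`
    -- decides its parity correctly.
    inner-sound : ∀ {k F d} {c : Fin d → Subset n} R → d ≤ k → Branching F c →
                  (∀ j → OddCorrect (c j)) → Transversal R F →
                  (¬ Sat S (evenᶠ k 0F) [] (R ∷ F ∷ coding)) ⇔ parity ∣ X ∩ F ∣ ≡ 1ℙ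
    inner-sound {k} {F} R d≤k br correct tr with ∣R∣≤d , same ← transversal-card R br correct tr =
      subst (λ p → (¬ Sat S (evenᶠ k 0F) [] (R ∷ F ∷ coding)) ⇔ p ≡ 1ℙ) same (mk⇔
        (λ ¬even → ≢0ℙ⇒≡1ℙ (¬even ∘ from (even⇔ k [] (R ∷ F ∷ coding) 0F (≤-trans ∣R∣≤d d≤k))))
        (λ odd even → 0ℙ≢1ℙ (trans (sym (to (even⇔ k [] (R ∷ F ∷ coding) 0F (≤-trans ∣R∣≤d d≤k)) even)) odd)))

    -- Whatever the four sets are, labels passing the checks are forced from the leaves upwards to
    -- be the true parities.
    oddCorrect : ∀ {k F} → (∀ G → SET S G → Sat S (leafᶠ ∧ᶠ innerᶠ k) [] (G ∷ coding)) →
                 Tree k F → SET S F → OddCorrect F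
    oddCorrect check (leaf u s) setF =
      ⇔-trans (mk⇔ (proj₁ leaf-check) (proj₂ leaf-check)) (leaf-parity X s)
      where
      leaf-check = proj₁ (check _ setF) u s
    oddCorrect {k} {F} check (inner c br d≤k ts) setF
      with R , tr , odd⇒ , ⇐odd ← proj₂ (check _ setF) (c zero , Branching.child br zero) =
      ⇔-trans (mk⇔ odd⇒ ⇐odd) (inner-sound R d≤k br
        (λ j → oddCorrect check (ts j) (proj₁ (Branching.child br j))) tr)

    leaf∧inner : ∀ {k F} → Tree k F → (∀ G → SET S G → OddCorrect G) → SET S F →
                 Sat S (leafᶠ ∧ᶠ innerᶠ k) [] (F ∷ coding)
    leaf∧inner {k} {F} t correct setF = leaf-check , inner-check t
      where
      leaf-check : Sat S leafᶠ [] (F ∷ coding)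
      leaf-check u s = to eq , from eq
        where
        eq = ⇔-trans (correct F setF) (⇔-sym (leaf-parity X s))
      correct-child : ∀ {F d} {c : Fin d → Subset n} → Branching F c → ∀ j → OddCorrect (c j)
      correct-child br j = correct _ (proj₁ (Branching.child br j))
      inner-check : Tree k F → Sat S (innerᶠ k) [] (F ∷ coding)
      inner-check (leaf u s) (C , ch) = contradiction ch (Sing-childless s)
      inner-check (inner c br d≤k ts) _ with R , tr ← transversal-exists br (correct-child br) =
        R , tr , to eq , from eq
        where
        eq = ⇔-trans (correct F setF) (⇔-sym (inner-sound R d≤k br (correct-child br) tr))

  subtree : ∀ {k F} → Tree k F → ∀ G → SET S G → Sub G F → Tree k G
  subtree {k} (leaf u s) G setG G⊆F = subst (Tree k) (sym (Sub-Sing {G = G} s setG G⊆F)) (leaf u s)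
  subtree (inner c br d≤k ts) G setG G⊆F with Branching.split br G setG G⊆F
  ... | inj₁ refl = inner c br d≤k ts
  ... | inj₂ (j , G⊆c) = subtree (ts j) G setG G⊆c

  -- If the checks succeed, the label of the full set is the parity of `∣ X ∣`, and `rootᶠ` requires
  -- it to be even. For even `∣ X ∣`, the four sets are obtained by realizing an even state at the
  -- root.
  evenCard⇔ : ∀ {k F} → Tree k F → SET S F → (∀ u → u ∈ F) → ∀ X →
              Sat S (evenCardᶠ k) [] (X ∷ []) ⇔ 2 ∣ ∣ X ∣
  evenCard⇔ {k} {F} t setF full X = ⇔-trans (mk⇔ ⇒ ⇐) (⇔-sym (2∣⇔parity≡0ℙ ∣ X ∣))
    where
    X∩F≡X : X ∩ F ≡ X
    X∩F≡X = ⊆-antisym (proj₁ ∘ x∈p∩q⁻ X F) λ u∈X → x∈p∩q⁺ (u∈X , full _)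
    ⇒ : Sat S (evenCardᶠ k) [] (X ∷ []) → parity ∣ X ∣ ≡ 0ℙ
    -- The outermost quantifier binds the highest index, so the witnesses come in the reverse order
    -- of `coding`.
    ⇒ (A₁₁ , A₁₀ , A₀₁ , A₀₀ , check) = ≢1ℙ⇒≡0ℙ λ odd → proj₂ (proj₂ (check F setF)) full
      (from (oddCorrect A X (λ G setG → let l , i , _ = check G setG in l , i) t setF)
        (trans (cong (parity ∘ ∣_∣) X∩F≡X) odd))
      where
      A : Bool → Bool → Subset n
      A false false = A₀₀
      A false true  = A₀₁
      A true  false = A₁₀
      A true  true  = A₁₁
    ⇐ : parity ∣ X ∣ ≡ 0ℙ → Sat S (evenCardᶠ k) [] (X ∷ [])
    -- Either even state would do at the root.
    ⇐ even with a , real ← realize {s = evenˢ false} X t (sym (trans (cong (parity ∘ ∣_∣) X∩F≡X) even)) =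
      A true true , A true false , A false true , A false false , λ G setG →
        let l , i = leaf∧inner A X (subtree t G setG (λ u _ → full u)) correct setG
        in l , i , λ fullG odd → 0ℙ≢1ℙ (trans (sym even) (trans
             (cong parity (cong ∣_∣ (sym (X∩G≡X G fullG)))) (to (correct G setG) odd)))
      where
      A? = λ h e u → holds h e (a u) ≟ true
      A = λ h e → ⟪ A? h e ⟫
      correct : ∀ G → SET S G → OddCorrect A X G
      correct G setG = proj₂ (real A (λ h e _ → ∈⟪⟫ (A? h e))) G setG λ u _ → full u
      X∩G≡X : ∀ G → (∀ u → u ∈ G) → X ∩ G ≡ X
      X∩G≡X G fullG = ⊆-antisym (proj₁ ∘ x∈p∩q⁻ X G) λ u∈X → x∈p∩q⁺ (u∈X , fullG _)

  -- From the laminar tree to a tree of sets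

  record Represents (t : RootedTree) (f : Node t → Subset n) : Set where
    field
      sets : ∀ v → SET S (f v)
      desc : ∀ u v → (u ⊑ v) ⇔ (f u ⊆ f v)
      -- Surjectivity is relative to the set of the root, so that the notion passes to subtrees.
      surj : ∀ F → SET S F → F ⊆ f (rootOf t) → ∃ λ v → f v ≡ F

    singleton-node : Laminar S → ∀ {u} → u ∈ f (rootOf t) → ∃ λ v → f v ≡ ⁅ u ⁆
    singleton-node lam {u} u∈F = surj ⁅ u ⁆ (Laminar.singletons lam u)
      λ v∈ → subst (_∈ f (rootOf t)) (sym (x∈⁅y⁆⇒x≡y u v∈)) u∈F

  represents-child : ∀ {d c f} → Represents (node d c) f → ∀ j → Represents (c j) (f ∘ below j)
  represents-child {c = c} {f} rep j = record
    { sets = sets ∘ below j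
    ; desc = λ u v → ⇔-trans (mk⇔ ⊑-below below-injective) (desc (below j u) (below j v))
    ; surj = λ F setF F⊆ → find F⊆ (surj F setF (λ x∈F → to (desc (below j (rootOf (c j))) root) ⊑-root (F⊆ x∈F)))
    }
    where
    open Represents rep
    find : ∀ {F} → F ⊆ f (below j (rootOf (c j))) → (∃ λ v → f v ≡ F) → ∃ λ v → f (below j v) ≡ F
    find F⊆ (v , refl) with w , refl ← below-inversion (from (desc v (below j (rootOf (c j)))) F⊆) = w , refl

  -- Covering and disjointness come from the singletons: the node of `⁅ u ⁆` is a descendant of
  -- every node whose set contains `u`, and it cannot be below two different children.
  branching : ∀ {d c f} → Laminar S → Represents (node (suc d) c) f →
              Branching (f root) (λ j → f (below j (rootOf (c j))))
  branching {d} {c} {f} lam rep = record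
    { child    = λ j → sets _ , sets _ , (λ _ → to (desc (top j) root) ⊑-root) , F⊈ j , maximal j
    ; split    = λ G setG G⊆F → split (surj G setG (Sub⇒⊆ {G} {f root} G⊆F))
    ; cover    = cover
    ; disjoint = disjoint
    }
    where
    open Represents rep
    top : Fin (suc d) → Node (node (suc d) c)
    top j = below j (rootOf (c j))
    below⊑top : ∀ j w → f (below j w) ⊆ f (top j)
    below⊑top j w = to (desc (below j w) (top j)) (⊑-below (⊑-rootOf w))
    F⊈ : ∀ j → ¬ Sub (f root) (f (top j))
    F⊈ j F⊆ with () ← from (desc root (top j)) (Sub⇒⊆ {f root} {f (top j)} F⊆)
    split : ∀ {G} → (∃ λ v → f v ≡ G) → G ≡ f root ⊎ ∃ λ j → Sub G (f (top j))
    split (root , refl)      = inj₁ refl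
    split (below j w , refl) = inj₂ (j , λ _ → below⊑top j w)
    maximal : ∀ j G → SET S G → Sub (f (top j)) G → Sub G (f root) → Sub G (f (top j)) ⊎ Sub (f root) G
    maximal j G setG c⊆G G⊆F with surj G setG (Sub⇒⊆ {G} {f root} G⊆F)
    ... | root , refl = inj₂ λ _ → id
    ... | v@(below i w) , refl with below-inversion (from (desc (top j) v) (Sub⇒⊆ {f (top j)} {f v} c⊆G))
    ...   | _ , refl = inj₁ λ _ → below⊑top j w
    cover : ∀ {u} → u ∈ f root → ∃ λ j → u ∈ f (top j)
    cover {u} u∈F with singleton-node lam u∈F
    ... | below j w , eq = j , below⊑top j w (subst (u ∈_) (sym eq) (x∈⁅x⁆ u))
    -- Here the set of the root is `⁅ u ⁆`, and a non-empty child inside it contains `u`.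
    ... | root , eq with v , v∈ ← SET-nonempty (sets (top zero)) = zero , subst (_∈ f (top zero))
          (x∈⁅y⁆⇒x≡y u (subst (v ∈_) eq (to (desc (top zero) root) ⊑-root v∈))) v∈
    disjoint : Disjoint (f ∘ top)
    disjoint {u} {i} {j} u∈cᵢ u∈cⱼ with v , eq ← singleton-node lam (to (desc (top i) root) ⊑-root u∈cᵢ) =
      below-unique (from (desc v (top i)) (inside u∈cᵢ)) (from (desc v (top j)) (inside u∈cⱼ))
      where
      inside : ∀ {F} → u ∈ F → f v ⊆ F
      inside {F} u∈F {x} x∈ = subst (_∈ F) (sym (x∈⁅y⁆⇒x≡y u (subst (x ∈_) eq x∈))) u∈F

  buildTree : ∀ {k} t {f} → Laminar S → Represents t f → downDegree t ≤ k → Tree k (f (rootOf t))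
  buildTree (node zero c) {f} lam rep deg with u , u∈F ← SET-nonempty (Represents.sets rep root)
    -- The node of the singleton `⁅ u ⁆` can only be the root.
    with root , eq ← Represents.singleton-node rep lam u∈F =
    leaf u (u∈F , λ v v∈F → x∈⁅y⁆⇒x≡y u (subst (v ∈_) eq v∈F))
  -- A single child would cover its parent, although it is a proper subset.
  buildTree (node (suc zero) c) {f} lam rep deg =
    contradiction F⊆c (proj₁ (proj₂ (proj₂ (proj₂ (Branching.child br zero)))))
    where
    br = branching lam rep
    F⊆c : Sub (f root) (f (below zero (rootOf (c zero))))
    F⊆c u u∈F with zero , u∈c ← Branching.cover br u∈F = u∈c
  buildTree (node (suc (suc d)) c) lam rep deg =
    inner _ (branching lam rep) (≤-trans (m≤m⊔n (suc (suc d)) (foldr _⊔_ 0 (downDegree ∘ c))) deg) λ j →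
      buildTree (c j) lam (represents-child rep j)
        (≤-trans (lookup≤foldr-⊔ (downDegree ∘ c) j) (≤-trans (m≤n⊔m (suc (suc d)) (foldr _⊔_ 0 (downDegree ∘ c))) deg))

theorem3 : (k : ℕ) → .{{_ : NonZero k}} →
    ∃ λ (EVEN : MSO 0 1) →
    (S : SetSystem) → 𝓛 k S → (X : Subset (size S)) →
    (S ⊨ EVEN [ X ]) ⇔ (2 ∣ ∣ X ∣)
theorem3 k = evenCardᶠ k , evenCard
  where
  evenCard : (S : SetSystem) → 𝓛 k S → (X : Subset (size S)) → (S ⊨ evenCardᶠ k [ X ]) ⇔ (2 ∣ ∣ X ∣)
  evenCard S (lam , t , isTree , deg) =
    evenCard⇔ (buildTree t lam rep deg) (set-SET (rootOf t)) λ u → top⊇ u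
    where
    open Semantics S
    open IsLaminarTree isTree
    rep : Represents t set
    rep = record { sets = set-SET ; desc = descendant ; surj = λ F setF _ → surjective F setF }
    top⊇ : ∀ u → u ∈ set (rootOf t)
    -- The universe is the set of some node, and that node is a descendant of the root.
    top⊇ u with v , eq ← surjective ⊤ (Laminar.universe lam) =
      to (descendant v (rootOf t)) (⊑-rootOf v) (subst (u ∈_) (sym eq) ∈⊤)
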